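{- Let $P$ and $Q$ be two LTSs with the same signature $\{A^r,A^l,A^{bi}\}$, and let $p\in P$ and $q\in Q$. Then $(P,p)\lesssim_{cc}(Q,q)$ if and only if $(\mathcal{M}(P),p)\sqsubseteq(\mathcal{M}(Q),q)$.
   Context: A modal transition system (MTS) over a set of actions $A$ is a triple $(P,\to_\Diamond,\to_\Box)$ with $P$ a set of states and $\to_\Box\subseteq\to_\Diamond\subseteq P\times A\times P$ (must transitions $\to_\Box$, may transitions $\to_\Diamond$). A relation $R\subseteq P\times Q$ is a refinement relation between MTSs $P$ and $Q$ if whenever $p\,R\,q$: (i) $p\xrightarrow{a}_\Box p'$ implies there is $q'$ with $q\xrightarrow{a}_\Box q'$ and $p'\,R\,q'$; (ii) $q\xrightarrow{a}_\Diamond q'$ implies there is $p'$ with $p\xrightarrow{a}_\Diamond p'$ and $p'\,R\,q'$. Write $(P,p)\sqsubseteq(Q,q)$ if $p\,R\,q$ for some refinement relation $R$. A labelled transition system (LTS) over $A$ is a set of states $P$ with a transition relation $\to\subseteq P\times A\times P$. A signature is a partition $\{A^r,A^l,A^{bi}\}$ of $A$ into pairwise disjoint, possibly empty sets. A covariant-contravariant simulation between LTSs $P$ and $Q$ with this signature is a relation $R\subseteq P\times Q$ such that whenever $p\,R\,q$: for all $a\in A^r\cup A^{bi}$ and $p\xrightarrow{a}p'$ there is $q\xrightarrow{a}q'$ with $p'\,R\,q'$; and for all $a\in A^l\cup A^{bi}$ and $q\xrightarrow{a}q'$ there is $p\xrightarrow{a}p'$ with $p'\,R\,q'$. Write $(P,p)\lesssim_{cc}(Q,q)$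 if $p\,R\,q$ for some such $R$. For an LTS $P$ with signature $\{A^r,A^l,A^{bi}\}$, the MTS $\mathcal{M}(P)$ over $A=A^r\cup A^l\cup A^{bi}$ has as states those of $P$ plus a new state $u$, and exactly the following transitions: $p\xrightarrow{a}_\Diamond p'$ for each $p\xrightarrow{a}p'$ in $P$; $p\xrightarrow{a}_\Box p'$ for each $p\xrightarrow{a}p'$ in $P$ with $a\in A^r\cup A^{bi}$; $p\xrightarrow{a}_\Diamond u$ for each $a\in A^r$ and state $p$ of $P$; $u\xrightarrow{a}_\Diamond u$ for each $a\in A$. -}

module Defs where

open import Data.Product.Base using (Σ-syntax; ∃-syntax; _×_; _,_)
open import Level using (Level; _⊔_; suc)
open import Relation.Binary.Core using (REL)
open import Relation.Unary using (Pred; _∈_; _∪_; _⊥_; Universal)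

private
  variable
    a s p q t₁ t₂ : Level
    A : Set a

record LTS (A : Set a) (p t : Level) : Set (a ⊔ suc (p ⊔ t)) where
  field
    State   : Set p
    _─[_]→_ : State → A → State → Set t

record MTS (A : Set a) (p t : Level) : Set (a ⊔ suc (p ⊔ t)) where
  field
    State    : Set p
    _─[_]→◇_ : State → A → State → Set t
    _─[_]→□_ : State → A → State → Set t
    □⊆◇      : ∀ {x α y} → x ─[ α ]→□ y → x ─[ α ]→◇ y

-- The three blocks may be empty. Since _∪_ is a constructive disjoint sum,
-- the covering condition computes the block of each action.
record Signature (A : Set a) (s : Level) : Set (a ⊔ suc s) where
  field
    Aʳ Aˡ Aᵇⁱ : Pred A s
    r⊥l       : Aʳ ⊥ Aˡ
    r⊥bi      : Aʳ ⊥ Aᵇⁱ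
    l⊥bi      : Aˡ ⊥ Aᵇⁱ
    covers    : Universal (Aʳ ∪ Aˡ ∪ Aᵇⁱ)

record IsRefinement {A : Set a} (P : MTS A p t₁) (Q : MTS A q t₂) {ℓ}
                    (R : REL (MTS.State P) (MTS.State Q) ℓ)
                    : Set (a ⊔ p ⊔ q ⊔ t₁ ⊔ t₂ ⊔ ℓ) where
  private
    module P = MTS P
    module Q = MTS Q
  field
    must : ∀ {x y} → R x y → ∀ {α x′} → x P.─[ α ]→□ x′ →
           ∃[ y′ ] (y Q.─[ α ]→□ y′) × R x′ y′
    may  : ∀ {x y} → R x y → ∀ {α y′} → y Q.─[ α ]→◇ y′ →
           ∃[ x′ ] (x P.─[ α ]→◇ x′) × R x′ y′

record IsCCSimulation {A : Set a} (σ : Signature A s)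
                      (P : LTS A p t₁) (Q : LTS A q t₂) {ℓ}
                      (R : REL (LTS.State P) (LTS.State Q) ℓ)
                      : Set (a ⊔ s ⊔ p ⊔ q ⊔ t₁ ⊔ t₂ ⊔ ℓ) where
  open Signature σ
  private
    module P = LTS P
    module Q = LTS Q
  field
    covariant     : ∀ {x y} → R x y →
                    ∀ {α x′} → α ∈ Aʳ ∪ Aᵇⁱ → x P.─[ α ]→ x′ →
                    ∃[ y′ ] (y Q.─[ α ]→ y′) × R x′ y′
    contravariant : ∀ {x y} → R x y →
                    ∀ {α y′} → α ∈ Aˡ ∪ Aᵇⁱ → y Q.─[ α ]→ y′ →
                    ∃[ x′ ] (x P.─[ α ]→ x′) × R x′ y′

-- In both preorders, ℓ is the universe level of the witnessing relation: in a
-- predicative theory one cannot quantify over relations of all levels at once.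

Refines : ∀ ℓ (P : MTS A p t₁) (Q : MTS A q t₂) →
          REL (MTS.State P) (MTS.State Q) _
Refines ℓ P Q x y =
  Σ[ R ∈ REL (MTS.State P) (MTS.State Q) ℓ ] IsRefinement P Q R × R x y

CCSimulated : ∀ ℓ (σ : Signature A s) (P : LTS A p t₁) (Q : LTS A q t₂) →
              REL (LTS.State P) (LTS.State Q) _
CCSimulated ℓ σ P Q x y =
  Σ[ R ∈ REL (LTS.State P) (LTS.State Q) ℓ ] IsCCSimulation σ P Q R × R x y

syntax Refines ℓ P Q x y = ⟨ P , x ⟩⊑[ ℓ ]⟨ Q , y ⟩
syntax CCSimulated ℓ σ P Q x y = ⟨ P , x ⟩≲cc[ ℓ , σ ]⟨ Q , y ⟩

data WithU (S : Set p) : Set p where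
  old : S → WithU S
  u   : WithU S

module _ {A : Set a} {t} (σ : Signature A s) (P : LTS A p t) where
  open Signature σ
  open LTS P

  data ℳ-May : WithU State → A → WithU State → Set (a ⊔ s ⊔ p ⊔ t) where
    step : ∀ {x α y} → x ─[ α ]→ y → ℳ-May (old x) α (old y)
    to-u : ∀ {x α} → α ∈ Aʳ → ℳ-May (old x) α u
    loop : ∀ {α} → ℳ-May u α u

  data ℳ-Must : WithU State → A → WithU State → Set (a ⊔ s ⊔ p ⊔ t) where
    step : ∀ {x α y} → α ∈ Aʳ ∪ Aᵇⁱ → x ─[ α ]→ y → ℳ-Must (old x) α (old y)

  ℳ : MTS A p (a ⊔ s ⊔ p ⊔ t)
  ℳ = record
    { State    = WithU State
    ; _─[_]→◇_ = ℳ-May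
    ; _─[_]→□_ = ℳ-Must
    ; □⊆◇      = λ { (step _ x→y) → step x→y }
    }

{-# OPTIONS --safe #-}
-- The state u has every may transition and no must transition, so it is related
-- to every state of ℳ(Q). A transition of Q labelled in Aʳ, which P need not
-- simulate, is matched by the move to u; conversely, since only actions of Aʳ
-- lead from P to u, a match for an action of Aˡ ∪ Aᵇⁱ is a transition of P.
module Submission where

open import Data.Empty using (⊥-elim)
open import Data.Empty.Polymorphic using (⊥)
open import Data.Product.Base using (∃-syntax; _×_; _,_)
open import Data.Sum.Base using (inj₁; inj₂)
open import Data.Unit.Polymorphic using (⊤; tt)
open import Defs
open import Function.Bundles using (_⇔_; mk⇔)
open import Level using (Level)
open import Relation.Binary.Core using (REL)
open import Relation.Unary using (_∈_; _∪_)

private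
  variable
    a s p q t₁ t₂ ℓ : Level
    A : Set a
    S : Set p
    T : Set q

-- `old x` is never related to `u`: `u` has no must transition to answer those of `x`, and its may
-- loops would demand moves that `x` need not have.
extend : REL S T ℓ → REL (WithU S) (WithU T) ℓ
extend R (old x) (old y) = R x y
extend R (old x) u       = ⊥
extend R u       _       = ⊤

restrict : REL (WithU S) (WithU T) ℓ → REL S T ℓ
restrict R x y = R (old x) (old y)

module _ (σ : Signature A s) (P : LTS A p t₁) (Q : LTS A q t₂) where
  open Signature σ

  extend-isRefinement : {R : REL (LTS.State P) (LTS.State Q) ℓ} →
                        IsCCSimulation σ P Q R →
                        IsRefinement (ℳ σ P) (ℳ σ Q) (extend R)
  extend-isRefinement {R = R} sim = record { must = must ; may = may }
    where
    open IsCCSimulation sim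

    must : ∀ {x y} → extend R x y → ∀ {α x′} → ℳ-Must σ P x α x′ →
           ∃[ y′ ] ℳ-Must σ Q y α y′ × extend R x′ y′
    -- No clause for `y = u`: there `xRy` would inhabit `⊥`.
    must {y = old _} xRy (step α∈ x→x′) =
      let y′ , y→y′ , x′Ry′ = covariant xRy α∈ x→x′
      in old y′ , step α∈ y→y′ , x′Ry′

    may : ∀ {x y} → extend R x y → ∀ {α y′} → ℳ-May σ Q y α y′ →
          ∃[ x′ ] ℳ-May σ P x α x′ × extend R x′ y′
    may {u}     _   _           = u , loop , tt
    may {old _} xRy (to-u α∈Aʳ) = u , to-u α∈Aʳ , tt
    may {old _} xRy {α} (step y→y′) with covers α
    ... | inj₁ α∈Aʳ = u , to-u α∈Aʳ , tt
    -- `_∪_` associates to the right, so this summand is exactly the premise of `contravariant`.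
    ... | inj₂ α∈   =
      let x′ , x→x′ , x′Ry′ = contravariant xRy α∈ y→y′
      in old x′ , step x→x′ , x′Ry′

  restrict-isCCSimulation :
    {R : REL (WithU (LTS.State P)) (WithU (LTS.State Q)) ℓ} →
    IsRefinement (ℳ σ P) (ℳ σ Q) R →
    IsCCSimulation σ P Q (restrict R)
  restrict-isCCSimulation {R = R} ref = record
    { covariant     = λ xRy α∈ x→x′ → case-must (must xRy (step α∈ x→x′))
    ; contravariant = λ xRy α∈ y→y′ → case-may α∈ (may xRy (step y→y′))
    }
    where
    open IsRefinement ref

    case-must : ∀ {x′ y α} →
                ∃[ y′ ] ℳ-Must σ Q (old y) α y′ × R (old x′) y′ →
                ∃[ y′ ] LTS._─[_]→_ Q y α y′ × restrict R x′ y′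
    case-must (_ , step _ y→y′ , x′Ry′) = _ , y→y′ , x′Ry′

    case-may : ∀ {x y′ α} → α ∈ Aˡ ∪ Aᵇⁱ →
               ∃[ x′ ] ℳ-May σ P (old x) α x′ × R x′ (old y′) →
               ∃[ x′ ] LTS._─[_]→_ P x α x′ × restrict R x′ y′
    case-may _            (_ , step x→x′ , x′Ry′) = _ , x→x′ , x′Ry′
    case-may (inj₁ α∈Aˡ)  (_ , to-u α∈Aʳ , _) = ⊥-elim (r⊥l (α∈Aʳ , α∈Aˡ))
    case-may (inj₂ α∈Aᵇⁱ) (_ , to-u α∈Aʳ , _) = ⊥-elim (r⊥bi (α∈Aʳ , α∈Aᵇⁱ))

corollary4 : ∀ {a s p q t₁ t₂ : Level} (ℓ : Level) {A : Set a}
    (σ : Signature A s) (P : LTS A p t₁) (Q : LTS A q t₂)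
    (x : LTS.State P) (y : LTS.State Q) →
    (⟨ P , x ⟩≲cc[ ℓ , σ ]⟨ Q , y ⟩) ⇔ (⟨ ℳ σ P , old x ⟩⊑[ ℓ ]⟨ ℳ σ Q , old y ⟩)
corollary4 ℓ σ P Q x y = mk⇔
  -- `xRy` serves unchanged both ways, since `extend` and `restrict` agree with `R` on old states by
  -- computation.
  (λ (R , sim , xRy) → extend R   , extend-isRefinement σ P Q sim     , xRy)
  (λ (R , ref , xRy) → restrict R , restrict-isCCSimulation σ P Q ref , xRy)
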